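{- The identities (A9) $x\wedge(y\wedge z)\approx z\wedge(y\wedge x)$, (J4) $x''\approx x$, (J5) $x'\approx (x\wedge y)'\wedge(x\wedge y')'$ form a 3-base for the variety $\mathbb{BA}$ of Boolean algebras (in the language $\langle\wedge,{}'\rangle$).
   Context: Algebras are of type $\langle \wedge, {}'\rangle$ with $\wedge$ binary and ${}'$ unary. The variety $\mathbb{BA}$ of Boolean algebras in this language consists of the algebras $\langle B,\wedge,{}'\rangle$ obtained from Boolean algebras by keeping only meet and complement (equivalently, the variety generated by the two-element Boolean algebra with meet and complement). A base for a variety is an independent set of identities (no identity in the set follows from the others) that defines the variety; an $n$-base is a base with exactly $n$ identities. -}

module Defs where

open import Algebra.Core using (Op₁; Op₂)
open import Algebra.Lattice.Structures using (IsBooleanAlgebra)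
open import Data.Fin.Base using (Fin; zero; suc)
open import Data.Nat.Base using (ℕ)
open import Data.Product.Base using (Σ-syntax)
open import Function.Bundles using (_⇔_)
open import Level as Level using (Level; _⊔_)
open import Relation.Binary.Core using (Rel)
open import Relation.Binary.PropositionalEquality.Core using (_≢_)
open import Relation.Binary.Structures using (IsEquivalence)
open import Relation.Nullary.Negation.Core using (¬_)

infixr 7 _∧_
infix  8 _′
infix  4 _≋_

data Term : Set where
  var : ℕ → Term
  _∧_ : Term → Term → Term
  _′  : Term → Term

record Identity : Set where
  constructor _≋_
  field
    lhs rhs : Term

-- Equality is a setoid equality, so that quotients are available.  Algebras
-- are nonempty, as usual in universal algebra; `point` only witnesses this and
-- is not an operation.  Without it the empty algebra would satisfy every
-- identity while not being the reduct of any Boolean algebra.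
record Algebra (c ℓ : Level) : Set (Level.suc (c ⊔ ℓ)) where
  field
    Carrier       : Set c
    _≈_           : Rel Carrier ℓ
    isEquivalence : IsEquivalence _≈_
    meet          : Op₂ Carrier
    compl         : Op₁ Carrier
    meet-cong     : ∀ {x y u v} → x ≈ y → u ≈ v → meet x u ≈ meet y v
    compl-cong    : ∀ {x y} → x ≈ y → compl x ≈ compl y
    point         : Carrier

  ⟦_⟧ : Term → (ℕ → Carrier) → Carrier
  ⟦ var n ⟧ ρ = ρ n
  ⟦ s ∧ t ⟧ ρ = meet (⟦ s ⟧ ρ) (⟦ t ⟧ ρ)
  ⟦ t ′ ⟧   ρ = compl (⟦ t ⟧ ρ)

infix 4 _⊨_

_⊨_ : ∀ {c ℓ} → Algebra c ℓ → Identity → Set (c ⊔ ℓ)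
A ⊨ (s ≋ t) = ∀ ρ → ⟦ s ⟧ ρ ≈ ⟦ t ⟧ ρ
  where open Algebra A

Class : (c ℓ : Level) → Set (Level.suc (c ⊔ ℓ))
Class c ℓ = Algebra c ℓ → Set (c ⊔ ℓ)

BA : ∀ {c ℓ} → Class c ℓ
BA A =
  Σ[ join ∈ Op₂ Carrier ] Σ[ ⊤ ∈ Carrier ] Σ[ ⊥ ∈ Carrier ]
    IsBooleanAlgebra _≈_ join meet compl ⊤ ⊥
  where open Algebra A

-- A base is given as a family of identities indexed by Fin n.  Independence
-- makes the members pairwise distinct, so the set has exactly n elements.
module _ (c ℓ : Level) {n : ℕ} (E : Fin n → Identity) where

  FollowsFromOthers : Fin n → Set (Level.suc (c ⊔ ℓ))
  FollowsFromOthers i =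
    ∀ (A : Algebra c ℓ) → (∀ j → j ≢ i → A ⊨ E j) → A ⊨ E i

  Independent : Set (Level.suc (c ⊔ ℓ))
  Independent = ∀ i → ¬ FollowsFromOthers i

  Defines : Class c ℓ → Set (Level.suc (c ⊔ ℓ))
  Defines V = ∀ (A : Algebra c ℓ) → V A ⇔ (∀ i → A ⊨ E i)

record IsBase (c ℓ : Level) (n : ℕ) (E : Fin n → Identity) (V : Class c ℓ)
              : Set (Level.suc (c ⊔ ℓ)) where
  field
    independent : Independent c ℓ E
    defines     : Defines c ℓ E V

private
  x y z : Term
  x = var 0
  y = var 1
  z = var 2

A9 J4 J5 : Identity
A9 = x ∧ (y ∧ z) ≋ z ∧ (y ∧ x)
J4 = x ′ ′ ≋ x
J5 = x ′ ≋ (x ∧ y) ′ ∧ (x ∧ y ′) ′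

A9-J4-J5 : Fin 3 → Identity
A9-J4-J5 zero             = A9
A9-J4-J5 (suc zero)       = J4
A9-J4-J5 (suc (suc zero)) = J5

{-# OPTIONS --safe #-}

-- Commutativity is the crux.  (A9) yields (x ∧ y) ∧ (z ∧ w) ≈ (x ∧ z) ∧ (y ∧ w).
-- The element p = (x ∧ (z ∧ z))′ = (z ∧ (z ∧ x))′ occurs in (J5) expansions of both
-- x′ and z′, so x′ = p ∧ a = a ∧ p and z′ = p ∧ b = b ∧ p for some a and b, and
-- x′ ∧ z′ = (p ∧ a) ∧ (b ∧ p) = (p ∧ b) ∧ (a ∧ p) = z′ ∧ x′; now apply (J4).
-- Associativity is then (A9) up to commutativity, and (J5) is the dual of
-- Huntington's axiom, from which Boolean algebra follows.  Each identity is
-- independent of the others already on a two-element algebra.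
module Submission where

open import Defs
open import Algebra.Bundles using (CommutativeMonoid; CommutativeSemigroup)
open import Algebra.Core using (Op₁; Op₂)
open import Algebra.Lattice.Bundles using (BooleanAlgebra)
open import Algebra.Lattice.Structures using (IsBooleanAlgebra)
import Algebra.Lattice.Properties.BooleanAlgebra as BooleanAlgebraProperties
import Algebra.Lattice.Structures.Biased as Biased
import Algebra.Properties.CommutativeSemigroup as CommutativeSemigroupProperties
open import Data.Bool.Base using (Bool; true; false)
open import Data.Fin.Base using (zero; suc)
open import Data.Nat.Base using (ℕ; zero; suc)
open import Data.Product.Base using (_,_)
open import Function.Base using (const; id)
open import Function.Bundles using (mk⇔)
open import Level using (Level; Lift; lift; lower)
open import Relation.Binary.Bundles using (Setoid)
open import Relation.Binary.PropositionalEquality.Core as ≡ using (_≡_; _≢_)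
import Relation.Binary.Reasoning.Setoid as SetoidReasoning
open import Relation.Nullary.Negation.Core using (contradiction)

private
  variable
    c ℓ : Level

-- The identities mention only `var 0` to `var 2`; the value at larger indices is an arbitrary
-- default.
valuation : {A : Set c} → A → A → A → ℕ → A
valuation x y z zero          = x
valuation x y z (suc zero)    = y
valuation x y z (suc (suc _)) = z

-- Soundness of the identities in Boolean algebras.

module BooleanAlgebra⇒Identities (B : BooleanAlgebra c ℓ) where

  open BooleanAlgebra B using (setoid; _≈_; _∨_; ¬_; ⊤; ∧-congˡ; ∧-distribˡ-∨; ∨-complementʳ; ¬-cong)
    renaming (_∧_ to infixr 7 _∙_)
  open BooleanAlgebraProperties B

  ∧-⊤-commutativeMonoid : CommutativeMonoid c ℓ
  ∧-⊤-commutativeMonoid = record { isCommutativeMonoid = ∧-⊤-isCommutativeMonoid }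

  open CommutativeSemigroupProperties (CommutativeMonoid.commutativeSemigroup ∧-⊤-commutativeMonoid)
    public using (x∙yz≈z∙yx)
  open SetoidReasoning setoid

  j5 : ∀ x y → ¬ x ≈ ¬ (x ∙ y) ∙ ¬ (x ∙ ¬ y)
  j5 x y = begin
    ¬ x                        ≈⟨ ¬-cong (∧-identityʳ x) ⟨
    ¬ (x ∙ ⊤)                  ≈⟨ ¬-cong (∧-congˡ (∨-complementʳ y)) ⟨
    ¬ (x ∙ (y ∨ ¬ y))          ≈⟨ ¬-cong (∧-distribˡ-∨ x y (¬ y)) ⟩
    ¬ ((x ∙ y) ∨ (x ∙ ¬ y))    ≈⟨ deMorgan₂ (x ∙ y) (x ∙ ¬ y) ⟩
    ¬ (x ∙ y) ∙ ¬ (x ∙ ¬ y)    ∎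

-- From the identities to commutativity and associativity.

module Identities⇒BooleanAlgebra (A : Algebra c ℓ) where

  open Algebra A renaming (_≈_ to infix 4 _≈_; meet to infixl 7 _∙_; compl to infix 8 _⁻)

  private
    setoid : Setoid _ _
    setoid = record { isEquivalence = isEquivalence }

  open Setoid setoid using (refl; sym; trans)
  open SetoidReasoning setoid

  module _
    (a9 : ∀ x y z → x ∙ (y ∙ z) ≈ z ∙ (y ∙ x))
    (j4 : ∀ x → x ⁻ ⁻ ≈ x)
    (j5 : ∀ x y → x ⁻ ≈ (x ∙ y) ⁻ ∙ (x ∙ y ⁻) ⁻)
    where

    private
      ∙-congˡ : ∀ {x y z} → y ≈ z → x ∙ y ≈ x ∙ z
      ∙-congˡ = meet-cong refl

      ∙-congʳ : ∀ {x y z} → y ≈ z → y ∙ x ≈ z ∙ x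
      ∙-congʳ y≈z = meet-cong y≈z refl

    -- `a9` swaps the outer factors of a right-nested product: first with `x ∙ y` as one factor,
    -- then inside, then with `x ∙ z` as one factor.
    medial : ∀ x y z w → (x ∙ y) ∙ (z ∙ w) ≈ (x ∙ z) ∙ (y ∙ w)
    medial x y z w = begin
      (x ∙ y) ∙ (z ∙ w)  ≈⟨ a9 (x ∙ y) z w ⟩
      w ∙ (z ∙ (x ∙ y))  ≈⟨ ∙-congˡ (a9 z x y) ⟩
      w ∙ (y ∙ (x ∙ z))  ≈⟨ a9 w y (x ∙ z) ⟩
      (x ∙ z) ∙ (y ∙ w)  ∎

    -- Expanding by `y ⁻` reverses the two factors, so both orders are available before
    -- commutativity.
    j5-swap : ∀ x y → x ⁻ ≈ (x ∙ y ⁻) ⁻ ∙ (x ∙ y) ⁻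
    j5-swap x y = trans (j5 x (y ⁻)) (∙-congˡ (compl-cong (∙-congˡ (j4 y))))

    ⁻-comm : ∀ x z → x ⁻ ∙ z ⁻ ≈ z ⁻ ∙ x ⁻
    ⁻-comm x z = begin
      x ⁻ ∙ z ⁻          ≈⟨ meet-cong (j5 x (z ∙ z)) z⁻≈b∙p ⟩
      (p ∙ a) ∙ (b ∙ p)  ≈⟨ medial p a b p ⟩
      (p ∙ b) ∙ (a ∙ p)  ≈⟨ meet-cong p∙b≈z⁻ (sym (j5-swap x (z ∙ z))) ⟩
      z ⁻ ∙ x ⁻          ∎
      where
      p a b : Carrier
      p = (x ∙ (z ∙ z)) ⁻
      a = (x ∙ (z ∙ z) ⁻) ⁻
      b = (z ∙ (z ∙ x) ⁻) ⁻

      p≈ : p ≈ (z ∙ (z ∙ x)) ⁻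
      p≈ = compl-cong (a9 x z z)

      z⁻≈b∙p : z ⁻ ≈ b ∙ p
      z⁻≈b∙p = trans (j5-swap z (z ∙ x)) (∙-congˡ (sym p≈))

      p∙b≈z⁻ : p ∙ b ≈ z ⁻
      p∙b≈z⁻ = trans (∙-congʳ p≈) (sym (j5 z (z ∙ x)))

    comm : ∀ x y → x ∙ y ≈ y ∙ x
    comm x y = begin
      x ∙ y          ≈⟨ meet-cong (j4 x) (j4 y) ⟨
      x ⁻ ⁻ ∙ y ⁻ ⁻  ≈⟨ ⁻-comm (x ⁻) (y ⁻) ⟩
      y ⁻ ⁻ ∙ x ⁻ ⁻  ≈⟨ meet-cong (j4 y) (j4 x) ⟩
      y ∙ x          ∎

    assoc : ∀ x y z → (x ∙ y) ∙ z ≈ x ∙ (y ∙ z)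
    assoc x y z = begin
      (x ∙ y) ∙ z  ≈⟨ comm (x ∙ y) z ⟩
      z ∙ (x ∙ y)  ≈⟨ ∙-congˡ (comm x y) ⟩
      z ∙ (y ∙ x)  ≈⟨ a9 z y x ⟩
      x ∙ (y ∙ z)  ∎

    commutativeSemigroup : CommutativeSemigroup c ℓ
    commutativeSemigroup = record
      { isCommutativeSemigroup = record
        { isSemigroup = record
          { isMagma = record { isEquivalence = isEquivalence ; ∙-cong = meet-cong }
          ; assoc   = assoc
          }
        ; comm = comm
        }
      }

    open CommutativeSemigroupProperties commutativeSemigroup using (xy∙z≈xz∙y)

    -- Constants, idempotence and complements.

    ⊥ ⊤ : Carrier
    -- Nonemptiness supplies the element; by `x∙x⁻≈y∙y⁻` any other gives an equal value.
    ⊥ = point ∙ point ⁻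
    ⊤ = ⊥ ⁻

    -- Expanding x and x ⁻ by y gives the meet of all four (x ∙ y) ⁻, …,
    -- (x ⁻ ∙ y ⁻) ⁻, which is symmetric in x and y.
    x∙x⁻≈y∙y⁻ : ∀ x y → x ∙ x ⁻ ≈ y ∙ y ⁻
    x∙x⁻≈y∙y⁻ x y = begin
      x ∙ x ⁻
        ≈⟨ meet-cong (trans (sym (j4 x)) (j5-swap (x ⁻) y)) (j5-swap x y) ⟩
      ((x ⁻ ∙ y ⁻) ⁻ ∙ (x ⁻ ∙ y) ⁻) ∙ ((x ∙ y ⁻) ⁻ ∙ (x ∙ y) ⁻)
        ≈⟨ medial _ _ _ _ ⟩
      ((x ⁻ ∙ y ⁻) ⁻ ∙ (x ∙ y ⁻) ⁻) ∙ ((x ⁻ ∙ y) ⁻ ∙ (x ∙ y) ⁻)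
        ≈⟨ meet-cong (meet-cong (swap (x ⁻) (y ⁻)) (swap x (y ⁻)))
                     (meet-cong (swap (x ⁻) y) (swap x y)) ⟩
      ((y ⁻ ∙ x ⁻) ⁻ ∙ (y ⁻ ∙ x) ⁻) ∙ ((y ∙ x ⁻) ⁻ ∙ (y ∙ x) ⁻)
        ≈⟨ meet-cong (trans (sym (j4 y)) (j5-swap (y ⁻) x)) (j5-swap y x) ⟨
      y ∙ y ⁻
        ∎
      where
      swap : ∀ u v → (u ∙ v) ⁻ ≈ (v ∙ u) ⁻
      swap u v = compl-cong (comm u v)

    inverseʳ : ∀ x → x ∙ x ⁻ ≈ ⊥
    inverseʳ x = x∙x⁻≈y∙y⁻ x point

    -- This is `j5` with `y` equal to `x`. The square can be removed only after `⊥` and `⊤` are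
    -- shown idempotent.
    [x∙x]⁻∙⊤≈x⁻ : ∀ x → (x ∙ x) ⁻ ∙ ⊤ ≈ x ⁻
    [x∙x]⁻∙⊤≈x⁻ x = begin
      (x ∙ x) ⁻ ∙ ⊤            ≈⟨ ∙-congˡ (compl-cong (inverseʳ x)) ⟨
      (x ∙ x) ⁻ ∙ (x ∙ x ⁻) ⁻  ≈⟨ j5 x x ⟨
      x ⁻                      ∎

    -- Multiplied by `⊥`, the right side takes the form `u ∙ u ⁻` with `u` equal to `⊥ ∙ ⊥`, which
    -- is `⊥` again; this gives `⊥∙⊥≈⊥`.
    ⊥≈⊥∙[⊥∙⊥]⁻ : ⊥ ≈ ⊥ ∙ (⊥ ∙ ⊥) ⁻
    ⊥≈⊥∙[⊥∙⊥]⁻ = begin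
      ⊥                                              ≈⟨ j4 ⊥ ⟨
      ⊤ ⁻                                            ≈⟨ j5-swap ⊤ (⊥ ∙ ⊥) ⟩
      (⊤ ∙ (⊥ ∙ ⊥) ⁻) ⁻ ∙ (⊤ ∙ (⊥ ∙ ⊥)) ⁻            ≈⟨ meet-cong (compl-cong ⊤∙[⊥∙⊥]⁻≈⊤) (compl-cong ⊤∙[⊥∙⊥]≈⊥∙⊥) ⟩
      ⊤ ⁻ ∙ (⊥ ∙ ⊥) ⁻                                ≈⟨ ∙-congʳ (j4 ⊥) ⟩
      ⊥ ∙ (⊥ ∙ ⊥) ⁻                                  ∎
      where
      ⊤∙[⊥∙⊥]⁻≈⊤ : ⊤ ∙ (⊥ ∙ ⊥) ⁻ ≈ ⊤
      ⊤∙[⊥∙⊥]⁻≈⊤ = trans (comm _ _) ([x∙x]⁻∙⊤≈x⁻ ⊥)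

      ⊤∙[⊥∙⊥]≈⊥∙⊥ : ⊤ ∙ (⊥ ∙ ⊥) ≈ ⊥ ∙ ⊥
      ⊤∙[⊥∙⊥]≈⊥∙⊥ = begin
        ⊤ ∙ (⊥ ∙ ⊥)  ≈⟨ a9 ⊤ ⊥ ⊥ ⟩
        ⊥ ∙ (⊥ ∙ ⊤)  ≈⟨ ∙-congˡ (inverseʳ ⊥) ⟩
        ⊥ ∙ ⊥        ∎

    ⊥∙⊥≈⊥ : ⊥ ∙ ⊥ ≈ ⊥
    ⊥∙⊥≈⊥ = begin
      ⊥ ∙ ⊥                ≈⟨ ∙-congˡ ⊥≈⊥∙[⊥∙⊥]⁻ ⟩
      ⊥ ∙ (⊥ ∙ (⊥ ∙ ⊥) ⁻)  ≈⟨ assoc ⊥ ⊥ _ ⟨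
      (⊥ ∙ ⊥) ∙ (⊥ ∙ ⊥) ⁻  ≈⟨ inverseʳ (⊥ ∙ ⊥) ⟩
      ⊥                    ∎

    ⊤∙⊤≈⊤ : ⊤ ∙ ⊤ ≈ ⊤
    ⊤∙⊤≈⊤ = begin
      ⊤ ∙ ⊤          ≈⟨ ∙-congʳ (compl-cong ⊥∙⊥≈⊥) ⟨
      (⊥ ∙ ⊥) ⁻ ∙ ⊤  ≈⟨ [x∙x]⁻∙⊤≈x⁻ ⊥ ⟩
      ⊤              ∎

    -- Every complement already has `⊤` as a factor, and `⊤` is idempotent.
    x⁻∙⊤≈x⁻ : ∀ x → x ⁻ ∙ ⊤ ≈ x ⁻
    x⁻∙⊤≈x⁻ x = begin
      x ⁻ ∙ ⊤                ≈⟨ ∙-congʳ ([x∙x]⁻∙⊤≈x⁻ x) ⟨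
      ((x ∙ x) ⁻ ∙ ⊤) ∙ ⊤    ≈⟨ assoc _ ⊤ ⊤ ⟩
      (x ∙ x) ⁻ ∙ (⊤ ∙ ⊤)    ≈⟨ ∙-congˡ ⊤∙⊤≈⊤ ⟩
      (x ∙ x) ⁻ ∙ ⊤          ≈⟨ [x∙x]⁻∙⊤≈x⁻ x ⟩
      x ⁻                    ∎

    -- `(x ∙ x) ⁻` and `x ⁻` both equal `(x ∙ x) ⁻ ∙ ⊤`; `j4` cancels the complements.
    idem : ∀ x → x ∙ x ≈ x
    idem x = begin
      x ∙ x              ≈⟨ j4 (x ∙ x) ⟨
      (x ∙ x) ⁻ ⁻        ≈⟨ compl-cong (x⁻∙⊤≈x⁻ (x ∙ x)) ⟨
      ((x ∙ x) ⁻ ∙ ⊤) ⁻  ≈⟨ compl-cong ([x∙x]⁻∙⊤≈x⁻ x) ⟩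
      x ⁻ ⁻              ≈⟨ j4 x ⟩
      x                  ∎

    -- By `j5-swap`, `(x ∙ y) ⁻` is a factor of `x ⁻`, so idempotence absorbs it. Both absorption
    -- laws come from this.
    x⁻∙[x∙y]⁻≈x⁻ : ∀ x y → x ⁻ ∙ (x ∙ y) ⁻ ≈ x ⁻
    x⁻∙[x∙y]⁻≈x⁻ x y = begin
      x ⁻ ∙ (x ∙ y) ⁻                        ≈⟨ ∙-congʳ (j5-swap x y) ⟩
      ((x ∙ y ⁻) ⁻ ∙ (x ∙ y) ⁻) ∙ (x ∙ y) ⁻  ≈⟨ assoc _ _ _ ⟩
      (x ∙ y ⁻) ⁻ ∙ ((x ∙ y) ⁻ ∙ (x ∙ y) ⁻)  ≈⟨ ∙-congˡ (idem _) ⟩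
      (x ∙ y ⁻) ⁻ ∙ (x ∙ y) ⁻                ≈⟨ j5-swap x y ⟨
      x ⁻                                    ∎

    -- One factor in the expansion of `x ⁻` by `y` becomes `⊤`, leaving `(x ∙ y ⁻) ⁻`.
    x∙y≈⊥⇒x∙y⁻≈x : ∀ {x y} → x ∙ y ≈ ⊥ → x ∙ y ⁻ ≈ x
    x∙y≈⊥⇒x∙y⁻≈x {x} {y} x∙y≈⊥ = begin
      x ∙ y ⁻                      ≈⟨ j4 _ ⟨
      (x ∙ y ⁻) ⁻ ⁻                ≈⟨ compl-cong (x⁻∙⊤≈x⁻ (x ∙ y ⁻)) ⟨
      ((x ∙ y ⁻) ⁻ ∙ ⊤) ⁻          ≈⟨ compl-cong (∙-congˡ (compl-cong x∙y≈⊥)) ⟨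
      ((x ∙ y ⁻) ⁻ ∙ (x ∙ y) ⁻) ⁻  ≈⟨ compl-cong (j5-swap x y) ⟨
      x ⁻ ⁻                        ≈⟨ j4 x ⟩
      x                            ∎

    -- The left side is disjoint from `y`, so a factor `y ⁻` may be added; that factor then absorbs
    -- `(x ∙ y) ⁻`.
    x∙[x∙y]⁻≈x∙y⁻ : ∀ x y → x ∙ (x ∙ y) ⁻ ≈ x ∙ y ⁻
    x∙[x∙y]⁻≈x∙y⁻ x y = begin
      x ∙ (x ∙ y) ⁻            ≈⟨ x∙y≈⊥⇒x∙y⁻≈x (trans (xy∙z≈xz∙y x _ y) (inverseʳ (x ∙ y))) ⟨
      (x ∙ (x ∙ y) ⁻) ∙ y ⁻    ≈⟨ xy∙z≈xz∙y x _ _ ⟩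
      (x ∙ y ⁻) ∙ (x ∙ y) ⁻    ≈⟨ assoc x _ _ ⟩
      x ∙ (y ⁻ ∙ (x ∙ y) ⁻)    ≈⟨ ∙-congˡ (∙-congˡ (compl-cong (comm x y))) ⟩
      x ∙ (y ⁻ ∙ (y ∙ x) ⁻)    ≈⟨ ∙-congˡ (x⁻∙[x∙y]⁻≈x⁻ y x) ⟩
      x ∙ y ⁻                  ∎

    -- Join, absorption and distributivity.

    infixl 6 _∪_

    _∪_ : Op₂ Carrier
    x ∪ y = (x ⁻ ∙ y ⁻) ⁻

    ∪-cong : ∀ {x y u v} → x ≈ y → u ≈ v → x ∪ u ≈ y ∪ v
    ∪-cong x≈y u≈v = compl-cong (meet-cong (compl-cong x≈y) (compl-cong u≈v))

    ∪-comm : ∀ x y → x ∪ y ≈ y ∪ x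
    ∪-comm x y = compl-cong (comm (x ⁻) (y ⁻))

    ∪-assoc : ∀ x y z → (x ∪ y) ∪ z ≈ x ∪ (y ∪ z)
    ∪-assoc x y z = compl-cong (begin
      (x ⁻ ∙ y ⁻) ⁻ ⁻ ∙ z ⁻  ≈⟨ ∙-congʳ (j4 _) ⟩
      (x ⁻ ∙ y ⁻) ∙ z ⁻      ≈⟨ assoc _ _ _ ⟩
      x ⁻ ∙ (y ⁻ ∙ z ⁻)      ≈⟨ ∙-congˡ (j4 _) ⟨
      x ⁻ ∙ (y ⁻ ∙ z ⁻) ⁻ ⁻  ∎)

    ∙-absorbs-∪ : ∀ x y → x ∙ (x ∪ y) ≈ x
    ∙-absorbs-∪ x y = begin
      x ∙ (x ∪ y)      ≈⟨ ∙-congʳ (j4 x) ⟨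
      x ⁻ ⁻ ∙ (x ∪ y)  ≈⟨ x⁻∙[x∙y]⁻≈x⁻ (x ⁻) (y ⁻) ⟩
      x ⁻ ⁻            ≈⟨ j4 x ⟩
      x                ∎

    ∪-absorbs-∙ : ∀ x y → x ∪ (x ∙ y) ≈ x
    ∪-absorbs-∙ x y = trans (compl-cong (x⁻∙[x∙y]⁻≈x⁻ x y)) (j4 x)

    -- Under a meet with `x`, `s` and `y ⁻ ∙ z ⁻` agree, hence so do their complements. Since `s ⁻`
    -- unfolds to `x ∙ y ∪ x ∙ z` and lies below `x`, the factor `x` drops out.
    ∙-distribˡ-∪ : ∀ x y z → x ∙ (y ∪ z) ≈ x ∙ y ∪ x ∙ z
    ∙-distribˡ-∪ x y z = begin
      x ∙ (y ∪ z)                ≈⟨ x∙[x∙y]⁻≈x∙y⁻ x (y ⁻ ∙ z ⁻) ⟨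
      x ∙ (x ∙ (y ⁻ ∙ z ⁻)) ⁻    ≈⟨ ∙-congˡ (compl-cong x∙s≈x∙y⁻∙z⁻) ⟨
      x ∙ (x ∙ s) ⁻              ≈⟨ x∙[x∙y]⁻≈x∙y⁻ x s ⟩
      x ∙ s ⁻                    ≈⟨ comm x (s ⁻) ⟩
      s ⁻ ∙ x                    ≈⟨ ∙-congˡ s⁻∪x≈x ⟨
      s ⁻ ∙ (s ⁻ ∪ x)            ≈⟨ ∙-absorbs-∪ (s ⁻) x ⟩
      x ∙ y ∪ x ∙ z              ∎
      where
      s : Carrier
      s = (x ∙ y) ⁻ ∙ (x ∙ z) ⁻

      x∙s≈x∙y⁻∙z⁻ : x ∙ s ≈ x ∙ (y ⁻ ∙ z ⁻)
      x∙s≈x∙y⁻∙z⁻ = begin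
        x ∙ s                        ≈⟨ assoc x _ _ ⟨
        (x ∙ (x ∙ y) ⁻) ∙ (x ∙ z) ⁻  ≈⟨ ∙-congʳ (x∙[x∙y]⁻≈x∙y⁻ x y) ⟩
        (x ∙ y ⁻) ∙ (x ∙ z) ⁻        ≈⟨ xy∙z≈xz∙y x _ _ ⟩
        (x ∙ (x ∙ z) ⁻) ∙ y ⁻        ≈⟨ ∙-congʳ (x∙[x∙y]⁻≈x∙y⁻ x z) ⟩
        (x ∙ z ⁻) ∙ y ⁻              ≈⟨ xy∙z≈xz∙y x _ _ ⟩
        (x ∙ y ⁻) ∙ z ⁻              ≈⟨ assoc x _ _ ⟩
        x ∙ (y ⁻ ∙ z ⁻)              ∎

      s⁻∪x≈x : s ⁻ ∪ x ≈ x
      s⁻∪x≈x = begin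
        x ∙ y ∪ x ∙ z ∪ x    ≈⟨ ∪-assoc _ _ _ ⟩
        x ∙ y ∪ (x ∙ z ∪ x)  ≈⟨ ∪-cong refl (trans (∪-comm _ x) (∪-absorbs-∙ x z)) ⟩
        x ∙ y ∪ x            ≈⟨ ∪-comm _ x ⟩
        x ∪ x ∙ y            ≈⟨ ∪-absorbs-∙ x y ⟩
        x                    ∎

    ∙-distribʳ-∪ : ∀ x y z → (y ∪ z) ∙ x ≈ y ∙ x ∪ z ∙ x
    ∙-distribʳ-∪ x y z = begin
      (y ∪ z) ∙ x    ≈⟨ comm _ x ⟩
      x ∙ (y ∪ z)    ≈⟨ ∙-distribˡ-∪ x y z ⟩
      x ∙ y ∪ x ∙ z  ≈⟨ ∪-cong (comm x y) (comm x z) ⟩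
      y ∙ x ∪ z ∙ x  ∎

    -- With `_∙_` read as join, `∙-distribʳ-∪` is the required distributivity of join over meet;
    -- dualizing afterwards restores the roles.
    dualBooleanAlgebra : BooleanAlgebra c ℓ
    dualBooleanAlgebra = record
      { _∨_ = _∙_
      ; _∧_ = _∪_
      ; isBooleanAlgebra = Biased.isBooleanAlgebraʳ record
        { isDistributiveLattice = Biased.isDistributiveLatticeʳʲᵐ record
          { isLattice = record
            { isEquivalence = isEquivalence
            ; ∨-comm        = comm
            ; ∨-assoc       = assoc
            ; ∨-cong        = meet-cong
            ; ∧-comm        = ∪-comm
            ; ∧-assoc       = ∪-assoc
            ; ∧-cong        = ∪-cong
            ; absorptive    = ∙-absorbs-∪ , ∪-absorbs-∙
            }
          ; ∨-distribʳ-∧ = ∙-distribʳ-∪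
          }
        ; ∨-complementʳ = inverseʳ
        -- `x ∪ x ⁻` unfolds to `(x ⁻ ∙ x ⁻ ⁻) ⁻`.
        ; ∧-complementʳ = λ x → compl-cong (inverseʳ (x ⁻))
        ; ¬-cong        = compl-cong
        }
      }

    isBooleanAlgebra : IsBooleanAlgebra _≈_ _∪_ _∙_ _⁻ ⊤ ⊥
    isBooleanAlgebra = BooleanAlgebraProperties.∧-∨-isBooleanAlgebra dualBooleanAlgebra

-- Axiomatization of the variety, then independence by two-element algebras.

defines : Defines c ℓ A9-J4-J5 BA
defines A = mk⇔ to from
  where
  open Algebra A

  to : BA A → ∀ i → A ⊨ A9-J4-J5 i
  to (_ , _ , _ , isBA) = λ
    { zero             ρ → x∙yz≈z∙yx (ρ 0) (ρ 1) (ρ 2)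
    ; (suc zero)       ρ → BooleanAlgebraProperties.¬-involutive B (ρ 0)
    ; (suc (suc zero)) ρ → j5 (ρ 0) (ρ 1)
    }
    where
    B : BooleanAlgebra _ _
    B = record { isBooleanAlgebra = isBA }
    open BooleanAlgebra⇒Identities B

  from : (∀ i → A ⊨ A9-J4-J5 i) → BA A
  from h = _ , _ , _ , Identities⇒BooleanAlgebra.isBooleanAlgebra A
    (λ x y z → h zero (valuation x y z))
    (λ x → h (suc zero) (const x))
    -- `J5` has no third variable; the repeated `y` is filler.
    (λ x y → h (suc (suc zero)) (valuation x y y))

-- Lifting places the countermodels at every pair of levels.
boolAlgebra : ∀ c ℓ → Op₂ Bool → Op₁ Bool → Algebra c ℓ
boolAlgebra c ℓ _∙_ _⁻ = record
  { Carrier       = Lift c Bool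
  ; _≈_           = λ { (lift x) (lift y) → Lift ℓ (x ≡ y) }
  ; isEquivalence = record
    { refl  = lift ≡.refl
    ; sym   = λ { (lift p) → lift (≡.sym p) }
    ; trans = λ { (lift p) (lift q) → lift (≡.trans p q) }
    }
  ; meet       = λ { (lift x) (lift y) → lift (x ∙ y) }
  ; compl      = λ { (lift x) → lift (x ⁻) }
  ; meet-cong  = λ { (lift p) (lift q) → lift (≡.cong₂ _∙_ p q) }
  ; compl-cong = λ { (lift p) → lift (≡.cong _⁻ p) }
  ; point      = lift true
  }

independent : Independent c ℓ A9-J4-J5
independent {c} {ℓ} zero follows =
  contradiction (lower (follows M others (valuation (lift true) (lift true) (lift false)))) λ ()
  where
  M : Algebra c ℓ
  -- With left projection as meet, the sides of `A9` are `x` and `z`.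
  M = boolAlgebra c ℓ const id
  others : ∀ j → j ≢ zero → M ⊨ A9-J4-J5 j
  others zero             j≢i = contradiction ≡.refl j≢i
  others (suc zero)       _ _ = lift ≡.refl
  others (suc (suc zero)) _ _ = lift ≡.refl
independent {c} {ℓ} (suc zero) follows =
  contradiction (lower (follows M others (const (lift true)))) λ ()
  where
  M : Algebra c ℓ
  -- Double complement sends `true` to `false`.
  M = boolAlgebra c ℓ (λ _ _ → false) (const false)
  others : ∀ j → j ≢ suc zero → M ⊨ A9-J4-J5 j
  others zero             _ _ = lift ≡.refl
  others (suc zero)       j≢i = contradiction ≡.refl j≢i
  others (suc (suc zero)) _ _ = lift ≡.refl
independent {c} {ℓ} (suc (suc zero)) follows =
  contradiction (lower (follows M others (const (lift true)))) λ ()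
  where
  M : Algebra c ℓ
  -- At `true`, the left side of `J5` is `true`, while every meet is `false`.
  M = boolAlgebra c ℓ (λ _ _ → false) id
  others : ∀ j → j ≢ suc (suc zero) → M ⊨ A9-J4-J5 j
  others zero             _ _ = lift ≡.refl
  others (suc zero)       _ _ = lift ≡.refl
  others (suc (suc zero)) j≢i = contradiction ≡.refl j≢i

theorem7p1 : (c ℓ : Level) → IsBase c ℓ 3 A9-J4-J5 BA
theorem7p1 c ℓ = record
  { independent = independent
  ; defines     = defines
  }
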